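{- Let $G=(V,E)$ be a connected graph, $s,t\in V$, and suppose $|\delta(U)|\ge3$ for every $\emptyset\ne U\subsetneq V$ with $|U\cap\{s,t\}|\ne1$. Then the all-ones vector $\mathbf{1}\in\mathbb{R}^E$ can be expressed as a convex combination of (incidence vectors of) $\{s,t\}$-tours of $G$.
   Context: $\delta(U)$ denotes the set of edges of $G$ with exactly one endpoint in $U$. An $\{s,t\}$-tour of $G$ is a multiset of edges of $E$ forming a connected spanning multigraph on $V$ whose set of odd-degree vertices is $\{s\}\triangle\{t\}$ (i.e. $\{s,t\}$ if $s\ne t$, and empty if $s=t$); its incidence vector records multiplicities. -}

module Defs where

open import Data.Nat using (ℕ; zero; suc; _+_; _*_; _%_)
open import Data.Bool using (Bool; true; false; if_then_else_; _xor_)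
open import Data.Fin using (Fin; zero; suc; _≟_)
open import Data.Fin.Subset using (Subset; _∈_; _∉_; ⊤; ⁅_⁆; _∩_; _∪_; ∣_∣; Nonempty)
open import Data.Vec using (lookup)
open import Data.Integer using (+_)
open import Data.Rational using (ℚ; _/_; _≤_; 0ℚ; 1ℚ) renaming (_+_ to _+ℚ_; _*_ to _*ℚ_)
open import Data.Product using (Σ; _×_; _,_)
open import Relation.Nullary using (¬_)
open import Relation.Nullary.Decidable using (⌊_⌋)
open import Relation.Binary.PropositionalEquality using (_≡_; _≢_)

Σℕ : {k : ℕ} → (Fin k → ℕ) → ℕ
Σℕ {zero}  f = 0
Σℕ {suc k} f = f zero + Σℕ (λ i → f (suc i))

Σℚ : {k : ℕ} → (Fin k → ℚ) → ℚ
Σℚ {zero}  f = 0ℚ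
Σℚ {suc k} f = f zero +ℚ Σℚ (λ i → f (suc i))

-- A (multi)graph with vertex set Fin n and edge set Fin m; edge e joins
-- the vertices end₁ e and end₂ e.  Parallel edges allowed, loops excluded.
record Graph : Set where
  field
    n    : ℕ
    m    : ℕ
    end₁ : Fin m → Fin n
    end₂ : Fin m → Fin n
    loopless : ∀ e → end₁ e ≢ end₂ e
open Graph public

V : Graph → Set
V G = Fin (n G)

E : Graph → Set
E G = Fin (m G)

EdgeMultiset : Graph → Set
EdgeMultiset G = E G → ℕ

data Reach (G : Graph) (x : EdgeMultiset G) : V G → V G → Set where
  here : ∀ {a} → Reach G x a a
  fwd  : ∀ {b} (e : E G) → x e ≢ 0 → Reach G x (end₂ G e) b → Reach G x (end₁ G e) b
  bwd  : ∀ {b} (e : E G) → x e ≢ 0 → Reach G x (end₁ G e) b → Reach G x (end₂ G e) b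

ConnectedMS : (G : Graph) → EdgeMultiset G → Set
ConnectedMS G x = ∀ a b → Reach G x a b

Connected : Graph → Set
Connected G = ConnectedMS G (λ _ → 1)

ind : Bool → ℕ
ind b = if b then 1 else 0

deg : (G : Graph) → EdgeMultiset G → V G → ℕ
deg G x a = Σℕ (λ e → x e * (ind ⌊ end₁ G e ≟ a ⌋ + ind ⌊ end₂ G e ≟ a ⌋))

inSymDiff : {k : ℕ} → Fin k → Fin k → Fin k → Bool
inSymDiff s t a = ⌊ a ≟ s ⌋ xor ⌊ a ≟ t ⌋

IsTour : (G : Graph) → V G → V G → EdgeMultiset G → Set
IsTour G s t x = ConnectedMS G x × (∀ a → deg G x a % 2 ≡ ind (inSymDiff s t a))

cutSize : (G : Graph) → Subset (n G) → ℕ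
cutSize G U = Σℕ (λ e → ind (lookup U (end₁ G e) xor lookup U (end₂ G e)))

toℚ : ℕ → ℚ
toℚ k = (+ k) / 1

ConvexCombOfTours : (G : Graph) → V G → V G → Set
ConvexCombOfTours G s t =
  Σ ℕ λ k →
  Σ (Fin k → EdgeMultiset G) λ T →
  Σ (Fin k → ℚ) λ c →
    (∀ i → IsTour G s t (T i)) ×
    (∀ i → 0ℚ ≤ c i) ×
    (Σℚ c ≡ 1ℚ) ×
    (∀ e → Σℚ (λ i → c i *ℚ toℚ (T i e)) ≡ 1ℚ)

{-# OPTIONS --safe #-}

-- Suppose F₁, F₂, F₃ are connected spanning subgraphs such that every edge lies in at most two
-- of them, except that an edge forming a cut by itself may lie in all three.  F₃ contains a
-- T-join J, where T is the set of odd vertices of G with s and t switched, and by parity J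
-- avoids the one-edge cuts.  So every edge of J is missing from F₁ or from F₂: split J into
-- J₁, disjoint from F₁, and J₂, disjoint from F₂.  Then E − J₁ + J₂ and E − J₂ + J₁ are
-- {s,t}-tours, and their average is the all-ones vector.
--
-- The subgraphs exist by a tree packing argument (in the style of Kaiser's proof of the
-- Tutte–Nash-Williams theorem).  Starting from one block, repeatedly split the blocks into the
-- common refinement of the components of F₁, F₂, F₃ inside them.  If the stable partition has
-- p > 1 blocks, the cut condition gives 2·crossing ≥ 3p − 2, too many for three forests on the
-- blocks; so some crossing edge is redundant in its class, and moving it to a class where it
-- joins two components lexicographically decreases the numbers of components by level.
module Submission where

open import Defs
open import Data.Nat using (_≥_)
open import Data.Fin.Subset using (Subset; ⊤; ⁅_⁆; _∩_; _∪_; ∣_∣; Nonempty)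
open import Relation.Binary.PropositionalEquality using (_≢_)

open import Algebra.Properties.CommutativeSemigroup using (interchange)
open import Data.Bool using (Bool; true; false; not; _xor_)
open import Data.Fin as Fin using (Fin; zero; suc)
open import Data.Fin.Induction using () renaming (<-wellFounded to Fin-<-wellFounded)
open import Data.Fin.Properties using (any?; all?; <-cmp; suc-injective; ¬∀⟶∃¬)
open import Data.Fin.Subset as Subset using (∁)
open import Data.Fin.Subset.Properties
  using (anySubset?; nonempty?; Empty-unique; ∣⊥∣≡0; ∈⊤; x∈⁅y⁆⇒x≡y; x∈p∩q⁻; x∈p∪q⁻; x∉∁p⇒x∈p)
open import Data.List using (List; []; _∷_; length; filter; tabulate; allFin)
open import Data.List.Membership.Propositional using (_∈_; _∉_)
open import Data.List.Membership.Propositional.Properties using (∈-filter⁺; ∈-filter⁻; ∈-allFin)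
open import Data.List.Relation.Unary.All.Properties using (All¬⇒¬Any)
open import Data.List.Relation.Unary.AllPairs using (_∷_)
open import Data.List.Relation.Unary.Any using (here; there)
open import Data.List.Relation.Unary.Unique.Propositional using (Unique)
import Data.List.Relation.Unary.Unique.Propositional.Properties as Unique
open import Data.Nat using (ℕ; zero; suc; _+_; _*_; _^_; _%_; _≤_; _<_; z≤n; s≤s)
open import Data.Nat.DivMod using (%-distribˡ-+; %-distribˡ-*; m*n%n≡0; m%n<n; m%n%n≡m%n)
open import Data.Nat.Induction using (<-wellFounded)
open import Data.Nat.Properties hiding (<-cmp; suc-injective)
open import Data.Product using (∃; _×_; _,_; proj₁; proj₂)
open import Data.Rational as ℚ using (½; 1ℚ)
open import Data.Rational.Properties using (nonNegative⁻¹)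
open import Data.Sum using (_⊎_; inj₁; inj₂; [_,_])
open import Data.Unit using () renaming (⊤ to Unit)
open import Data.Vec as Vec using (lookup)
open import Data.Vec.Properties using (lookup∘tabulate; lookup-map; []=⇒lookup; lookup⇒[]=)
open import Function using (_∘_; id)
open import Induction.WellFounded using (Acc; acc)
open import Level using (0ℓ)
open import Relation.Binary using (IsEquivalence; Setoid; tri<; tri≈; tri>)
open import Relation.Binary.PropositionalEquality
  using (_≡_; refl; sym; trans; cong; cong₂; subst; isEquivalence)
import Relation.Binary.Reasoning.Setoid as SetoidReasoning
open import Relation.Nullary using (¬_; Dec; yes; no; contradiction)
open import Relation.Nullary.Decidable using (⌊_⌋; ¬?; _×-dec_; _⊎-dec_; decidable-stable)
open import Relation.Unary using (Pred; Decidable)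

-- Finite sums

Σ-cong : ∀ {k} {f g : Fin k → ℕ} → (∀ i → f i ≡ g i) → Σℕ f ≡ Σℕ g
Σ-cong {zero}  f≡g = refl
Σ-cong {suc k} f≡g = cong₂ _+_ (f≡g zero) (Σ-cong (f≡g ∘ suc))

Σ-mono : ∀ {k} {f g : Fin k → ℕ} → (∀ i → f i ≤ g i) → Σℕ f ≤ Σℕ g
Σ-mono {zero}  f≤g = z≤n
Σ-mono {suc k} f≤g = +-mono-≤ (f≤g zero) (Σ-mono (f≤g ∘ suc))

Σ-mono-< : ∀ {k} {f g : Fin k → ℕ} → (∀ i → f i ≤ g i) → ∀ j → f j < g j → Σℕ f < Σℕ g
Σ-mono-< f≤g zero    fj<gj = +-mono-<-≤ fj<gj (Σ-mono (f≤g ∘ suc))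
Σ-mono-< f≤g (suc j) fj<gj = +-mono-≤-< (f≤g zero) (Σ-mono-< (f≤g ∘ suc) j fj<gj)

Σ-const : ∀ k c → Σℕ {k} (λ _ → c) ≡ k * c
Σ-const zero    c = refl
Σ-const (suc k) c = cong (c +_) (Σ-const k c)

Σ-zero : ∀ {k} {f : Fin k → ℕ} → (∀ i → f i ≡ 0) → Σℕ f ≡ 0
Σ-zero {k} f≡0 = trans (Σ-cong f≡0) (trans (Σ-const k 0) (*-zeroʳ k))

Σ-+ : ∀ {k} (f g : Fin k → ℕ) → Σℕ (λ i → f i + g i) ≡ Σℕ f + Σℕ g
Σ-+ {zero}  f g = refl
Σ-+ {suc k} f g = trans (cong (f zero + g zero +_) (Σ-+ (f ∘ suc) (g ∘ suc)))
                        (interchange +-commutativeSemigroup (f zero) (g zero) _ _)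

Σ-*ˡ : ∀ {k} c (f : Fin k → ℕ) → Σℕ (λ i → c * f i) ≡ c * Σℕ f
Σ-*ˡ {zero}  c f = sym (*-zeroʳ c)
Σ-*ˡ {suc k} c f = trans (cong (c * f zero +_) (Σ-*ˡ c (f ∘ suc)))
                         (sym (*-distribˡ-+ c (f zero) _))

Σ-*ʳ : ∀ {k} c (f : Fin k → ℕ) → Σℕ (λ i → f i * c) ≡ Σℕ f * c
Σ-*ʳ c f = trans (Σ-cong λ i → *-comm (f i) c) (trans (Σ-*ˡ c f) (*-comm c _))

Σ-swap : ∀ {j k} (f : Fin j → Fin k → ℕ) →
         Σℕ (λ a → Σℕ (λ b → f a b)) ≡ Σℕ (λ b → Σℕ (λ a → f a b))
Σ-swap {zero}  {k} f = sym (Σ-zero {k} λ _ → refl)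
Σ-swap {suc j}     f = trans (cong (Σℕ (f zero) +_) (Σ-swap (f ∘ suc)))
                             (sym (Σ-+ (f zero) _))

Σ-single : ∀ {k} (f : Fin k → ℕ) j → (∀ i → i ≢ j → f i ≡ 0) → Σℕ f ≡ f j
Σ-single f zero    f≡0 = trans (cong (f zero +_) (Σ-zero λ i → f≡0 (suc i) λ ())) (+-identityʳ _)
Σ-single f (suc j) f≡0 = trans (cong (_+ Σℕ (f ∘ suc)) (f≡0 zero λ ()))
  (Σ-single (f ∘ suc) j λ i i≢j → f≡0 (suc i) λ { refl → i≢j refl })

term≤Σ : ∀ {k} (f : Fin k → ℕ) j → f j ≤ Σℕ f
term≤Σ f zero    = m≤m+n _ _
term≤Σ f (suc j) = ≤-trans (term≤Σ (f ∘ suc) j) (m≤n+m _ (f zero))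

two-terms≤Σ : ∀ {k} (f : Fin k → ℕ) {i j} → i ≢ j → f i + f j ≤ Σℕ f
two-terms≤Σ f {zero}  {zero}  i≢j = contradiction refl i≢j
two-terms≤Σ f {zero}  {suc j} i≢j = +-monoʳ-≤ (f zero) (term≤Σ (f ∘ suc) j)
two-terms≤Σ f {suc i} {zero}  i≢j =
  subst (_≤ Σℕ f) (+-comm (f zero) _) (+-monoʳ-≤ (f zero) (term≤Σ (f ∘ suc) i))
two-terms≤Σ f {suc i} {suc j} i≢j =
  ≤-trans (two-terms≤Σ (f ∘ suc) (i≢j ∘ cong suc)) (m≤n+m _ (f zero))

ind≤1 : ∀ b → ind b ≤ 1
ind≤1 true  = ≤-refl
ind≤1 false = z≤n

ind-mono : ∀ {P Q : Set} (P? : Dec P) (Q? : Dec Q) → (P → Q) → ind ⌊ P? ⌋ ≤ ind ⌊ Q? ⌋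
ind-mono (no _)  _       _   = z≤n
ind-mono (yes _) (yes _) _   = ≤-refl
ind-mono (yes p) (no ¬q) p⇒q = contradiction (p⇒q p) ¬q

ind-mono-< : ∀ {P Q : Set} (P? : Dec P) (Q? : Dec Q) → ¬ P → Q → ind ⌊ P? ⌋ < ind ⌊ Q? ⌋
ind-mono-< (yes p) _       ¬p _ = contradiction p ¬p
ind-mono-< (no _)  (yes _) _  _ = ≤-refl
ind-mono-< (no _)  (no ¬q) _  q = contradiction q ¬q

ind-yes : ∀ {P : Set} (P? : Dec P) → P → ind ⌊ P? ⌋ ≡ 1
ind-yes (yes _) _ = refl
ind-yes (no ¬p) p = contradiction p ¬p

count : ∀ {k} {P : Pred (Fin k) 0ℓ} → Decidable P → ℕ
count P? = Σℕ (λ i → ind ⌊ P? i ⌋)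

count-at-most-one : ∀ {k} {P : Pred (Fin k) 0ℓ} (P? : Decidable P) →
                    (∀ {i j} → P i → P j → i ≡ j) → count P? ≤ 1
count-at-most-one {zero}  P? unique = z≤n
count-at-most-one {suc k} P? unique with P? zero
... | no _  = count-at-most-one (P? ∘ suc) λ p q → suc-injective (unique p q)
... | yes p = s≤s (≤-reflexive (Σ-zero λ i → none i))
  where
  none : ∀ i → ind ⌊ P? (suc i) ⌋ ≡ 0
  none i with P? (suc i)
  ... | no _  = refl
  ... | yes q with () ← unique p q

length-filter-tabulate : ∀ {k} {A : Set} {P : Pred A 0ℓ} (P? : Decidable P) (f : Fin k → A) →
                         length (filter P? (tabulate f)) ≡ count (P? ∘ f)
length-filter-tabulate {zero}  P? f = refl
length-filter-tabulate {suc k} P? f with P? (f zero)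
... | yes _ = cong suc (length-filter-tabulate P? (f ∘ suc))
... | no _  = length-filter-tabulate P? (f ∘ suc)

-- Decidable equivalence relations and their number of classes

record DecEquiv (k : ℕ) : Set₁ where
  field
    rel   : Fin k → Fin k → Set
    rel?  : ∀ a b → Dec (rel a b)
    equiv : IsEquivalence rel
  open IsEquivalence equiv public using () renaming (refl to ~refl; sym to ~sym; trans to ~trans)
open DecEquiv

infix 4 _⊑_
_⊑_ : ∀ {k} → DecEquiv k → DecEquiv k → Set
P ⊑ Q = ∀ {a b} → rel P a b → rel Q a b

Discrete : ∀ {k} → DecEquiv k
Discrete = record { rel = _≡_ ; rel? = Fin._≟_ ; equiv = isEquivalence }

Total : ∀ {k} → DecEquiv k
Total = record
  { rel   = λ _ _ → Unit
  ; rel?  = λ _ _ → yes _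
  ; equiv = record { refl = _ ; sym = _ ; trans = _ } }

module _ {k : ℕ} (P : DecEquiv k) where

  Smaller : Fin k → Fin k → Set
  Smaller a b = b Fin.< a × rel P a b

  smaller? : ∀ a → Dec (∃ (Smaller a))
  smaller? a = any? λ b → (b Fin.<? a) ×-dec rel? P a b

  Least : Pred (Fin k) 0ℓ
  Least a = ¬ ∃ (Smaller a)

  least? : Decidable Least
  least? a = ¬? (smaller? a)

  -- Each class has exactly one least member, so counting these members counts the classes without
  -- forming a quotient.
  #classes : ℕ
  #classes = count least?

  least-in-class : ∀ a → ∃ λ r → Least r × rel P a r
  least-in-class a = go a (Fin-<-wellFounded a)
    where
    go : ∀ a → Acc Fin._<_ a → ∃ λ r → Least r × rel P a r
    go a (acc rs) with smaller? a
    ... | no ¬s = a , ¬s , ~refl P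
    ... | yes (b , b<a , a~b) with go b (rs b<a)
    ...   | r , lr , b~r = r , lr , ~trans P a~b b~r

  least-unique : ∀ {a b} → Least a → Least b → rel P a b → a ≡ b
  least-unique {a} {b} la lb a~b with <-cmp a b
  ... | tri< a<b _ _ = contradiction (a , a<b , ~sym P a~b) lb
  ... | tri≈ _ a≡b _ = a≡b
  ... | tri> _ _ b<a = contradiction (b , b<a , a~b) la

  #classes≥1 : Fin k → 1 ≤ #classes
  #classes≥1 a with least-in-class a
  ... | r , lr , _ = subst (_≤ #classes) (ind-yes (least? r) lr) (term≤Σ (λ a → ind ⌊ least? a ⌋) r)

  #classes≤k : #classes ≤ k
  #classes≤k = subst (#classes ≤_) (trans (Σ-const k 1) (*-identityʳ k)) (Σ-mono λ a → ind≤1 ⌊ least? a ⌋)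

module _ {k : ℕ} (P Q : DecEquiv k) (P⊑Q : P ⊑ Q) where

  least-mono : ∀ {a} → Least Q a → Least P a
  least-mono lq (b , b<a , a~b) = lq (b , b<a , P⊑Q a~b)

  #classes-mono : #classes Q ≤ #classes P
  #classes-mono = Σ-mono λ a → ind-mono (least? Q a) (least? P a) least-mono

  -- The least members of the `P`-classes of `x` and `y` are distinct but share a `Q`-class, so at
  -- least one of them is not least there.
  #classes-mono-< : ∀ {x y} → rel Q x y → ¬ rel P x y → #classes Q < #classes P
  #classes-mono-< {x} {y} x~y x≁y with least-in-class P x | least-in-class P y
  ... | r , lr , x~r | r′ , lr′ , y~r′ = lost (least? Q r) (least? Q r′)
    where
    drop : ∀ {z} → Least P z → ¬ Least Q z → #classes Q < #classes P
    drop {z} lz ¬lz = Σ-mono-< (λ a → ind-mono (least? Q a) (least? P a) least-mono) z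
                               (ind-mono-< (least? Q z) (least? P z) ¬lz lz)

    lost : Dec (Least Q r) → Dec (Least Q r′) → #classes Q < #classes P
    lost (no ¬l) _       = drop lr ¬l
    lost (yes _) (no ¬l) = drop lr′ ¬l
    lost (yes l) (yes l′)
      with refl ← least-unique Q l l′ (~trans Q (~sym Q (P⊑Q x~r)) (~trans Q x~y (P⊑Q y~r′)))
      = contradiction (~trans P x~r (~sym P y~r′)) x≁y

#classes-cong : ∀ {k} (P Q : DecEquiv k) → P ⊑ Q → Q ⊑ P → #classes P ≡ #classes Q
#classes-cong P Q P⊑Q Q⊑P = ≤-antisym (#classes-mono Q P Q⊑P) (#classes-mono P Q P⊑Q)

-- Equivalence relations generated by edges

-- A chain never needs the new pair more than once, so three cases already form an equivalence
-- relation, and decidability is inherited from `P`.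
join : ∀ {k} → DecEquiv k → Fin k → Fin k → DecEquiv k
join {k} P u v = record { rel = R ; rel? = R? ; equiv = record { refl = inj₁ (~refl P) ; sym = s ; trans = t } }
  where
  R : Fin k → Fin k → Set
  R a b = rel P a b ⊎ (rel P a u × rel P v b) ⊎ (rel P a v × rel P u b)

  R? : ∀ a b → Dec (R a b)
  R? a b = rel? P a b ⊎-dec ((rel? P a u ×-dec rel? P v b) ⊎-dec (rel? P a v ×-dec rel? P u b))

  s : ∀ {a b} → R a b → R b a
  s (inj₁ p)              = inj₁ (~sym P p)
  s (inj₂ (inj₁ (p , q))) = inj₂ (inj₂ (~sym P q , ~sym P p))
  s (inj₂ (inj₂ (p , q))) = inj₂ (inj₁ (~sym P q , ~sym P p))

  t : ∀ {a b c} → R a b → R b c → R a c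
  t (inj₁ p)              (inj₁ q)                = inj₁ (~trans P p q)
  t (inj₁ p)              (inj₂ (inj₁ (q , r)))   = inj₂ (inj₁ (~trans P p q , r))
  t (inj₁ p)              (inj₂ (inj₂ (q , r)))   = inj₂ (inj₂ (~trans P p q , r))
  t (inj₂ (inj₁ (p , q))) (inj₁ r)                = inj₂ (inj₁ (p , ~trans P q r))
  t (inj₂ (inj₂ (p , q))) (inj₁ r)                = inj₂ (inj₂ (p , ~trans P q r))
  t (inj₂ (inj₁ (p , q))) (inj₂ (inj₁ (q′ , r)))  = inj₂ (inj₁ (p , r))
  t (inj₂ (inj₁ (p , q))) (inj₂ (inj₂ (q′ , r)))  = inj₁ (~trans P p r)
  t (inj₂ (inj₂ (p , q))) (inj₂ (inj₁ (q′ , r)))  = inj₁ (~trans P p r)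
  t (inj₂ (inj₂ (p , q))) (inj₂ (inj₂ (q′ , r)))  = inj₂ (inj₂ (p , r))

join-joins : ∀ {k} (P : DecEquiv k) {u v} → rel (join P u v) u v
join-joins P = inj₂ (inj₁ (~refl P , ~refl P))

module Generated (G : Graph) where

  Equivalence : Set₁
  Equivalence = DecEquiv (n G)

  joins : Equivalence → E G → Set
  joins P e = rel P (end₁ G e) (end₂ G e)

  joins? : ∀ P → Decidable (joins P)
  joins? P e = rel? P (end₁ G e) (end₂ G e)

  closure : Equivalence → List (E G) → Equivalence
  closure P []       = P
  closure P (e ∷ es) = join (closure P es) (end₁ G e) (end₂ G e)

  closure-extends : ∀ P es → P ⊑ closure P es
  closure-extends P []       p = p
  closure-extends P (e ∷ es) p = inj₁ (closure-extends P es p)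

  closure-joins : ∀ P {es e} → e ∈ es → joins (closure P es) e
  closure-joins P {_ ∷ es} (here refl) = join-joins (closure P es)
  closure-joins P          (there e∈)  = inj₁ (closure-joins P e∈)

  -- `T` is not asked to be decidable, so that reachability by walks can be taken for it.
  closure-least : ∀ P es {T : V G → V G → Set} → IsEquivalence T → (∀ {a b} → rel P a b → T a b) →
                  (∀ e → e ∈ es → T (end₁ G e) (end₂ G e)) → ∀ {a b} → rel (closure P es) a b → T a b
  closure-least P []       T≈ P⊆T es⊆T p = P⊆T p
  closure-least P (e ∷ es) {T} T≈ P⊆T es⊆T p = go p
    where
    open IsEquivalence T≈ using () renaming (sym to T-sym; trans to T-trans)
    ih : ∀ {a b} → rel (closure P es) a b → T a b
    ih = closure-least P es T≈ P⊆T (λ f f∈ → es⊆T f (there f∈))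
    Te = es⊆T e (here refl)
    go : ∀ {a b} → rel (closure P (e ∷ es)) a b → T a b
    go (inj₁ p)              = ih p
    go (inj₂ (inj₁ (p , q))) = T-trans (ih p) (T-trans Te (ih q))
    go (inj₂ (inj₂ (p , q))) = T-trans (ih p) (T-trans (T-sym Te) (ih q))

  -- The edges are added from the end of the list. If each joins two different classes on arrival,
  -- each costs a class; otherwise one of them closes a cycle with those added before it, and
  -- `Unique` keeps it from being among them.
  closure-#classes : ∀ P es → Unique es →
    (#classes (closure P es) + length es ≤ #classes P) ⊎
    (∃ λ e → ∃ λ es′ → e ∈ es × e ∉ es′ × (∀ f → f ∈ es′ → f ∈ es) × joins (closure P es′) e)
  closure-#classes P []       _ = inj₁ (≤-reflexive (+-identityʳ _))
  closure-#classes P (e ∷ es) (e# ∷ u) with joins? (closure P es) e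
  ... | yes j = inj₂ (e , es , here refl , All¬⇒¬Any e# , (λ _ → there) , j)
  ... | no ¬j with closure-#classes P es u
  ...   | inj₂ (f , es′ , f∈ , f∉ , sub , j) = inj₂ (f , es′ , there f∈ , f∉ , (λ g → there ∘ sub g) , j)
  ...   | inj₁ le = inj₁ (≤-trans (≤-reflexive (+-suc _ (length es))) (≤-trans (+-monoˡ-≤ (length es)
          (#classes-mono-< (closure P es) (closure P (e ∷ es)) inj₁ (join-joins (closure P es)) ¬j)) le))

  generated : {S : Pred (E G) 0ℓ} → Decidable S → Equivalence
  generated S? = closure Discrete (filter S? (allFin (m G)))

  generated-joins : ∀ {S : Pred (E G) 0ℓ} (S? : Decidable S) {e} → S e → joins (generated S?) e
  generated-joins S? Se = closure-joins Discrete (∈-filter⁺ S? (∈-allFin _) Se)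

  generated-least : ∀ {S : Pred (E G) 0ℓ} (S? : Decidable S) {T : V G → V G → Set} → IsEquivalence T →
                    (∀ e → S e → T (end₁ G e) (end₂ G e)) → ∀ {a b} → rel (generated S?) a b → T a b
  generated-least S? T≈ S⊆T = closure-least Discrete _ T≈ (λ { refl → IsEquivalence.refl T≈ })
    (λ e e∈ → S⊆T e (proj₂ (∈-filter⁻ S? {xs = allFin (m G)} e∈)))

-- Three connected subgraphs

all-or-some : ∀ {k} {P Q : Pred (Fin k) 0ℓ} → (∀ i → P i ⊎ Q i) → (∀ i → P i) ⊎ ∃ Q
all-or-some {zero}  f = inj₁ λ ()
all-or-some {suc k} f with f zero | all-or-some (f ∘ suc)
... | inj₂ q | _            = inj₂ (zero , q)
... | inj₁ _ | inj₂ (i , q) = inj₂ (suc i , q)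
... | inj₁ p | inj₁ ps      = inj₁ λ { zero → p ; (suc i) → ps i }

module Packing (G : Graph) {B : Pred (E G) 0ℓ} (B? : Decidable B) where
  open Generated G

  Colouring : Set
  Colouring = E G → Fin 3

  -- The colour of an edge is the one class that omits it; edges of B are never omitted.
  Class : Colouring → Fin 3 → Pred (E G) 0ℓ
  Class col i e = B e ⊎ col e ≢ i

  class? : ∀ col i → Decidable (Class col i)
  class? col i e = B? e ⊎-dec ¬? (col e Fin.≟ i)

  Inside : Colouring → Equivalence → Fin 3 → Pred (E G) 0ℓ
  Inside col P i e = Class col i e × joins P e

  inside? : ∀ col P i → Decidable (Inside col P i)
  inside? col P i e = class? col i e ×-dec joins? P e

  components : Colouring → Equivalence → Fin 3 → Equivalence
  components col P i = generated (inside? col P i)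

  components⊑ : ∀ col P i → components col P i ⊑ P
  components⊑ col P i = generated-least (inside? col P i) (equiv P) (λ _ → proj₂)

  refine : Colouring → Equivalence → Equivalence
  refine col P = record
    { rel   = λ a b → ∀ i → rel (components col P i) a b
    ; rel?  = λ a b → all? λ i → rel? (components col P i) a b
    ; equiv = record
      { refl  = λ i → ~refl (components col P i)
      ; sym   = λ p i → ~sym (components col P i) (p i)
      ; trans = λ p q i → ~trans (components col P i) (p i) (q i) } }

  refine⊑ : ∀ col P → refine col P ⊑ P
  refine⊑ col P p = components⊑ col P zero (p zero)

  iterate : Colouring → ℕ → Equivalence → Equivalence
  iterate col zero    P = P
  iterate col (suc j) P = iterate col j (refine col P)

  iterate⊑ : ∀ col j P → iterate col j P ⊑ P
  iterate⊑ col zero    P p = p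
  iterate⊑ col (suc j) P p = refine⊑ col P (iterate⊑ col j (refine col P) p)

  -- An edge of `B` lies in every class, so no refinement can separate its ends.
  iterate-joins-B : ∀ col j P {e} → B e → joins P e → joins (iterate col j P) e
  iterate-joins-B col zero    P Be Pe = Pe
  iterate-joins-B col (suc j) P Be Pe = iterate-joins-B col j (refine col P) Be
    λ i → generated-joins (inside? col P i) (inj₁ Be , Pe)

  -- An unstable refinement adds a block, and there are at most `n G` blocks.
  stabilises : ∀ col fuel P → n G < #classes P + fuel →
               ∃ λ j → j < fuel × (iterate col j P ⊑ refine col (iterate col j P))
  stabilises col zero P n<c =
    contradiction (≤-trans n<c (subst (_≤ n G) (sym (+-identityʳ _)) (#classes≤k P))) (<-irrefl refl)
  stabilises col (suc fuel) P n<c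
    with any? (λ a → any? λ b → rel? P a b ×-dec ¬? (rel? (refine col P) a b))
  ... | no none = 0 , s≤s z≤n ,
        λ {a} {b} p → decidable-stable (rel? (refine col P) a b) λ ¬r → none (a , b , p , ¬r)
  ... | yes (a , b , p , ¬r) with stabilises col fuel (refine col P)
          (≤-trans n<c (subst (_≤ #classes (refine col P) + fuel) (sym (+-suc (#classes P) fuel))
            (+-monoˡ-≤ fuel (#classes-mono-< (refine col P) P (refine⊑ col P) p ¬r))))
  ...   | j , j<f , st = suc j , s≤s j<f , st

  Separated : Colouring → Equivalence → Equivalence → Fin 3 → Pred (E G) 0ℓ
  Separated col P R i e = Class col i e × joins P e × ¬ joins R e

  separated? : ∀ col P R i → Decidable (Separated col P R i)
  separated? col P R i e = class? col i e ×-dec (joins? P e ×-dec ¬? (joins? R e))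

  inside-except? : ∀ col P i e → Decidable (λ f → Inside col P i f × f ≢ e)
  inside-except? col P i e f = inside? col P i f ×-dec ¬? (f Fin.≟ e)

  record Redundant (col : Colouring) (P : Equivalence) (i : Fin 3) (e : E G) : Set where
    field
      separated : Separated col P (refine col P) i e
      bypass    : joins (generated (inside-except? col P i e)) e

  -- Start from the components inside the finer blocks and add the class `i` edges running between
  -- those blocks. The result is contained in the components of the coarser level, so
  -- `closure-#classes` gives either the count or a redundant edge.
  redundant-or-few : ∀ col P i →
    (#classes (components col P i) + count (separated? col P (refine col P) i)
       ≤ #classes (components col (refine col P) i))
    ⊎ ∃ (Redundant col P i)
  redundant-or-few col P i = result (closure-#classes R L (Unique.filter⁺ S? (Unique.allFin⁺ (m G))))
    where
    S? = separated? col P (refine col P) i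
    R  = components col (refine col P) i
    L  = filter S? (allFin (m G))

    from-L : ∀ {e} → e ∈ L → Separated col P (refine col P) i e
    from-L e∈ = proj₂ (∈-filter⁻ S? {xs = allFin (m G)} e∈)

    closure⊑ : closure R L ⊑ components col P i
    closure⊑ = closure-least R L (equiv (components col P i))
      (generated-least (inside? col (refine col P) i) (equiv (components col P i))
        λ e (ce , je) → generated-joins (inside? col P i) (ce , refine⊑ col P je))
      (λ e e∈ → let ce , je , _ = from-L e∈ in generated-joins (inside? col P i) (ce , je))

    result : (#classes (closure R L) + length L ≤ #classes R) ⊎
             (∃ λ e → ∃ λ es → e ∈ L × e ∉ es × (∀ f → f ∈ es → f ∈ L) × joins (closure R es) e) → _
    result (inj₁ le) = inj₁ (≤-trans
      (+-mono-≤ (#classes-mono (closure R L) (components col P i) closure⊑)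
                (≤-reflexive (sym (length-filter-tabulate S? id)))) le)
    result (inj₂ (e , es , e∈ , e∉ , es⊆L , j)) =
      inj₂ (e , record { separated = from-L e∈ ; bypass = closure-least R es (equiv T) R⊑T es⊑T j })
      where
      T = generated (inside-except? col P i e)

      -- The edges generating `R` stay inside the finer blocks, so none of them is `e`, which runs
      -- between two.
      R⊑T : R ⊑ T
      R⊑T = generated-least (inside? col (refine col P) i) (equiv T)
        λ f (cf , jf) → generated-joins (inside-except? col P i e)
          ((cf , refine⊑ col P jf) , λ { refl → proj₂ (proj₂ (from-L e∈)) jf })

      es⊑T : ∀ f → f ∈ es → joins T f
      es⊑T f f∈ = let cf , jf , _ = from-L (es⊆L f f∈) in
        generated-joins (inside-except? col P i e) ((cf , jf) , λ { refl → e∉ f∈ })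

  -- The one-level counts telescope: each level starts from the number of components at which the
  -- previous one ended.
  redundant-or-few-iterated : ∀ col i N P →
    (#classes (components col P i) + count (separated? col P (iterate col N P) i)
       ≤ #classes (components col (iterate col N P) i))
    ⊎ (∃ λ j → j < N × ∃ (Redundant col (iterate col j P) i))
  redundant-or-few-iterated col i zero P = inj₁ (≤-reflexive
    (trans (cong (#classes (components col P i) +_) (Σ-zero none)) (+-identityʳ _)))
    where
    none : ∀ e → ind ⌊ separated? col P P i e ⌋ ≡ 0
    none e with separated? col P P i e
    ... | yes (_ , j , ¬j) = contradiction j ¬j
    ... | no _             = refl
  redundant-or-few-iterated col i (suc N) P
    with redundant-or-few col P i | redundant-or-few-iterated col i N (refine col P)
  ... | inj₂ r  | _                    = inj₂ (0 , s≤s z≤n , r)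
  ... | inj₁ _  | inj₂ (j , j<N , r)   = inj₂ (suc j , s≤s j<N , r)
  ... | inj₁ le | inj₁ le′ = inj₁ (begin
    c + count (separated? col P Z i)                          ≤⟨ +-monoʳ-≤ c split ⟩
    c + (count (separated? col P R i) + count (separated? col R Z i)) ≡⟨ sym (+-assoc c _ _) ⟩
    c + count (separated? col P R i) + count (separated? col R Z i)   ≤⟨ +-monoˡ-≤ _ le ⟩
    #classes (components col R i) + count (separated? col R Z i)      ≤⟨ le′ ⟩
    #classes (components col Z i)                             ∎)
    where
    open ≤-Reasoning
    R = refine col P
    Z = iterate col N R
    c = #classes (components col P i)

    pointwise : ∀ e → ind ⌊ separated? col P Z i e ⌋ ≤
                      ind ⌊ separated? col P R i e ⌋ + ind ⌊ separated? col R Z i e ⌋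
    -- An edge separated by `Z` is either separated by `R` already, or lies inside a block of `R`
    -- and is separated later.
    pointwise e with joins? R e
    ... | yes Re = ≤-trans (ind-mono (separated? col P Z i e) (class? col i e ×-dec (yes Re ×-dec ¬? (joins? Z e)))
                     λ (ce , _ , ¬Z) → ce , Re , ¬Z) (m≤n+m _ (ind ⌊ class? col i e ×-dec (joins? P e ×-dec ¬? (yes Re)) ⌋))
    ... | no ¬Re = ≤-trans (ind-mono (separated? col P Z i e) (class? col i e ×-dec (joins? P e ×-dec ¬? (no ¬Re)))
                     λ (ce , Pe , _) → ce , Pe , ¬Re) (m≤m+n _ _)

    split : count (separated? col P Z i) ≤ count (separated? col P R i) + count (separated? col R Z i)
    split = ≤-trans (Σ-mono pointwise) (≤-reflexive (Σ-+ {m G} (λ e → ind ⌊ separated? col P R i e ⌋) _))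

  -- A lexicographic potential and the exchange that lowers it

  totalComponents : Colouring → Equivalence → ℕ
  totalComponents col P = Σℕ λ i → #classes (components col P i)

  base : ℕ
  base = suc (3 * n G)

  totalComponents<base : ∀ col P → totalComponents col P < base
  totalComponents<base col P = s≤s (≤-trans (Σ-mono {3} λ i → #classes≤k (components col P i))
                                            (≤-reflexive (Σ-const 3 (n G))))

  -- The sequence of component numbers at successive levels, compared
  -- lexicographically, is read as a number in a large enough base.
  potential : Colouring → ℕ → Equivalence → ℕ
  potential col zero    P = 0
  potential col (suc K) P = totalComponents col P * base ^ K + potential col K (refine col P)

  potential<base^ : ∀ col K P → potential col K P < base ^ K
  potential<base^ col zero    P = s≤s z≤n
  potential<base^ col (suc K) P = begin-strict
    totalComponents col P * base ^ K + potential col K (refine col P)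
      <⟨ +-monoʳ-< (totalComponents col P * base ^ K) (potential<base^ col K (refine col P)) ⟩
    totalComponents col P * base ^ K + base ^ K ≡⟨ +-comm _ (base ^ K) ⟩
    suc (totalComponents col P) * base ^ K      ≤⟨ *-monoˡ-≤ (base ^ K) (totalComponents<base col P) ⟩
    base * base ^ K                             ∎
    where open ≤-Reasoning

  recolour : Colouring → E G → Fin 3 → Colouring
  recolour col e i f with f Fin.≟ e
  ... | yes _ = i
  ... | no _  = col f

  recolour-same : ∀ col e i → recolour col e i e ≡ i
  recolour-same col e i with e Fin.≟ e
  ... | yes _  = refl
  ... | no e≢e = contradiction refl e≢e

  recolour-other : ∀ col {e f} i → f ≢ e → recolour col e i f ≡ col f
  recolour-other col {e} {f} i f≢e with f Fin.≟ e
  ... | yes f≡e = contradiction f≡e f≢e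
  ... | no _    = refl

  -- The edge e moves from class i, where it is bypassed, to class c, where it merges two
  -- components.  The bypass stays inside the block of level j that contains e, so the levels
  -- before j do not change.
  module Exchange (col : Colouring) (e : E G) (i c : Fin 3) (i≢c : i ≢ c) where

    col′ : Colouring
    col′ = recolour col e i

    keep : ∀ {x f} → f ≢ e → Class col x f → Class col′ x f
    keep {x} f≢e (inj₁ b) = inj₁ b
    keep {x} f≢e (inj₂ q) = inj₂ (q ∘ trans (sym (recolour-other col i f≢e)))

    keep⁻ : ∀ {x f} → f ≢ e → Class col′ x f → Class col x f
    keep⁻ {x} f≢e (inj₁ b) = inj₁ b
    keep⁻ {x} f≢e (inj₂ q) = inj₂ (q ∘ trans (recolour-other col i f≢e))

    gained : ∀ {x} → i ≢ x → Class col′ x e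
    gained i≢x = inj₂ (i≢x ∘ trans (sym (recolour-same col e i)))

    -- Only `e` needs care. In class `i` the bypass connects its ends; every other class contains
    -- `e` after the recolouring.
    components-grow : ∀ P P′ → P ⊑ P′ → joins P′ e → joins (generated (inside-except? col P i e)) e →
                      ∀ x → components col P x ⊑ components col′ P′ x
    components-grow P P′ P⊑P′ P′e bypass x = generated-least (inside? col P x) (equiv T) step
      where
      T = components col′ P′ x

      step : ∀ f → Inside col P x f → joins T f
      step f (cf , Pf) with f Fin.≟ e | i Fin.≟ x
      ... | no f≢e   | _        = generated-joins (inside? col′ P′ x) (keep f≢e cf , P⊑P′ Pf)
      ... | yes refl | no i≢x   = generated-joins (inside? col′ P′ x) (gained i≢x , P′e)
      ... | yes refl | yes refl = generated-least (inside-except? col P i e) (equiv T)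
        (λ g ((cg , Pg) , g≢e) → generated-joins (inside? col′ P′ x) (keep g≢e cg , P⊑P′ Pg)) bypass

    -- The ends of `e` are already joined in every class, so giving `e` to a class merges nothing.
    components-shrink : ∀ P P′ → P′ ⊑ P → joins (refine col P) e →
                        ∀ x → components col′ P′ x ⊑ components col P x
    components-shrink P P′ P′⊑P re x = generated-least (inside? col′ P′ x) (equiv (components col P x)) step
      where
      step : ∀ f → Inside col′ P′ x f → joins (components col P x) f
      step f (cf , P′f) = by-cases (f Fin.≟ e)
        where
        by-cases : Dec (f ≡ e) → joins (components col P x) f
        by-cases (yes refl) = re x
        by-cases (no f≢e)   = generated-joins (inside? col P x) (keep⁻ f≢e cf , P′⊑P P′f)

    -- At level `j` the bypass makes up for `e` in class `i`, while `e` merges two components of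
    -- class `c`. So that digit drops, and the later digits together are worth less than one unit of
    -- it. At earlier levels all counts agree. Two mutually contained partitions are carried along,
    -- since refinements under the two colourings agree only in this sense.
    potential-drops : ∀ j K P P′ → P ⊑ P′ → P′ ⊑ P → j < K → Redundant col (iterate col j P) i e →
                      ¬ joins (components col (iterate col j P) c) e →
                      potential col′ K P′ < potential col K P
    potential-drops zero (suc K) P P′ P⊑P′ P′⊑P _ red ¬c = begin-strict
      totalComponents col′ P′ * base ^ K + potential col′ K (refine col′ P′)
        <⟨ +-monoʳ-< (totalComponents col′ P′ * base ^ K) (potential<base^ col′ K (refine col′ P′)) ⟩
      totalComponents col′ P′ * base ^ K + base ^ K ≡⟨ +-comm _ (base ^ K) ⟩
      suc (totalComponents col′ P′) * base ^ K
        ≤⟨ *-monoˡ-≤ (base ^ K) (Σ-mono-< (λ x → #classes-mono (components col P x) (components col′ P′ x) (grow x)) c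
             (#classes-mono-< (components col P c) (components col′ P′ c) (grow c)
               (generated-joins (inside? col′ P′ c) (gained i≢c , P′e)) ¬c)) ⟩
      totalComponents col P * base ^ K ≤⟨ m≤m+n _ _ ⟩
      potential col (suc K) P ∎
      where
      open ≤-Reasoning
      open Redundant red
      P′e : joins P′ e
      P′e = P⊑P′ (proj₁ (proj₂ separated))
      grow = components-grow P P′ P⊑P′ P′e bypass
    potential-drops (suc j) (suc K) P P′ P⊑P′ P′⊑P (s≤s j<K) red ¬c =
      subst (λ z → z * base ^ K + potential col′ K (refine col′ P′) < potential col (suc K) P)
        (Σ-cong {3} λ x → #classes-cong (components col P x) (components col′ P′ x) (grow x) (shrink x))
        (+-monoʳ-< (totalComponents col P * base ^ K)
          (potential-drops j K (refine col P) (refine col′ P′)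
            (λ p x → grow x (p x)) (λ p x → shrink x (p x)) j<K red ¬c))
      where
      open Redundant red
      re : joins (refine col P) e
      re = iterate⊑ col j (refine col P) (proj₁ (proj₂ separated))
      -- A bypass inside the finer blocks of level `suc j` also lies inside the blocks of `P`.
      bypass-P : joins (generated (inside-except? col P i e)) e
      bypass-P = generated-least (inside-except? col (iterate col (suc j) P) i e)
        (equiv (generated (inside-except? col P i e)))
        (λ f ((cf , jf) , f≢e) → generated-joins (inside-except? col P i e)
          ((cf , iterate⊑ col (suc j) P jf) , f≢e)) bypass
      grow = components-grow P P′ P⊑P′ (P⊑P′ (refine⊑ col P re)) bypass-P
      shrink = components-shrink P P′ P′⊑P re

  -- As the refinement separates the ends of `e`, some class `c` does not join them within their
  -- block. Then `e` is not in class `c`, so `c` differs from `i`.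
  improve : ∀ col j K → j < K → ∀ i e → Redundant col (iterate col j Total) i e →
            ∃ λ col′ → potential col′ K Total < potential col K Total
  improve col j K j<K i e red
    with ¬∀⟶∃¬ 3 _ (λ c → joins? (components col (iterate col j Total) c) e)
           (proj₂ (proj₂ (Redundant.separated red)))
  ... | c , ¬c = Exchange.col′ col e i c i≢c ,
                 Exchange.potential-drops col e i c i≢c j K Total Total id id j<K red ¬c
    where
    sep = Redundant.separated red
    ¬class : ¬ Class col c e
    ¬class k = ¬c (generated-joins (inside? col (iterate col j Total) c) (k , proj₁ (proj₂ sep)))
    i≢c : i ≢ c
    i≢c refl = ¬class (proj₁ sep)

  -- Counting edges across a stable partition

  crossing : Equivalence → ℕ
  crossing P = count (λ e → ¬? (joins? P e))

  -- An edge can be omitted only by the class of its colour, so the other two contain it.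
  two-classes : ∀ col R e → 2 * ind ⌊ ¬? (joins? R e) ⌋ ≤ Σℕ (λ i → ind ⌊ separated? col Total R i e ⌋)
  two-classes col R e with joins? R e
  ... | yes _  = z≤n
  ... | no ¬Re = others (col e) refl
    where
    sep? : ∀ i → Dec (Separated col Total R i e)
    sep? i = class? col i e ×-dec (yes _ ×-dec ¬? (no ¬Re))
    in-class : ∀ {x} i → col e ≡ x → x ≢ i → ind ⌊ sep? i ⌋ ≡ 1
    in-class i refl x≢i = ind-yes (sep? i) (inj₂ x≢i , _ , ¬Re)
    pair : ∀ {x} i j → col e ≡ x → x ≢ i → x ≢ j → i ≢ j → 2 ≤ Σℕ (λ i → ind ⌊ sep? i ⌋)
    pair i j eq x≢i x≢j i≢j = subst (_≤ Σℕ (λ i → ind ⌊ sep? i ⌋)) (cong₂ _+_ (in-class i eq x≢i) (in-class j eq x≢j))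
                                    (two-terms≤Σ (λ i → ind ⌊ sep? i ⌋) i≢j)
    others : ∀ x → col e ≡ x → 2 ≤ Σℕ (λ i → ind ⌊ sep? i ⌋)
    others zero             eq = pair (suc zero) (suc (suc zero)) eq (λ ()) (λ ()) (λ ())
    others (suc zero)       eq = pair zero (suc (suc zero)) eq (λ ()) (λ ()) (λ ())
    others (suc (suc zero)) eq = pair zero (suc zero) eq (λ ()) (λ ()) (λ ())

  -- Each round of the search reaches a stable partition. Either it has one block, or a redundant
  -- edge allows an exchange that lowers the potential, or the classes have too few crossing edges
  -- for `many`.
  packing : V G →
    (∀ P → (∀ e → B e → joins P e) → (∃ λ a → ∃ λ b → ¬ rel P a b) →
       3 * #classes P ≤ 2 * crossing P + 2) →
    ∃ λ col → ∀ i a b → rel (generated (class? col i)) a b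
  packing v many = search (λ _ → zero) (<-wellFounded _)
    where
    -- More levels than vertices, so stability comes before level `K` and the potential covers every
    -- level at which an exchange takes place.
    K = suc (n G)

    search : ∀ col → Acc _<_ (potential col K Total) → ∃ λ col → ∀ i a b → rel (generated (class? col i)) a b
    search col (acc rs) with stabilises col K Total (m≤n+m _ (#classes (Total {n G})))
    ... | N , N<K , stable with any? (λ a → any? λ b → ¬? (rel? (iterate col N Total) a b))
    ...   | no total = col , λ i a b →
            generated-least (inside? col P i) (equiv (generated (class? col i)))
              (λ e (ce , _) → generated-joins (class? col i) ce)
              (stable (decidable-stable (rel? P a b) λ ¬p → total (a , b , ¬p)) i)
            where P = iterate col N Total
    ...   | yes apart with all-or-some (λ i → redundant-or-few-iterated col i N Total)
    ...     | inj₂ (i , j , j<N , e , red) =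
              let col′ , lt = improve col j K (<-trans j<N N<K) i e red in search col′ (rs lt)
    ...     | inj₁ few = contradiction too-many (<⇒≱ (+-monoʳ-< (2 * crossing P) (n<1+n 2)))
      where
      open ≤-Reasoning
      P = iterate col N Total
      s : Fin 3 → ℕ
      s i = count (separated? col Total P i)

      -- Class `i` has at least one component at the top level and, by stability, at most one per
      -- block at the last. So at most `#classes P` minus one of its edges cross.
      few′ : ∀ i → 1 + s i ≤ #classes P
      few′ i = ≤-trans (+-monoˡ-≤ (s i) (#classes≥1 (components col Total i) v))
        (≤-trans (few i) (#classes-mono P (components col P i) (λ p → stable p i)))

      too-many : 2 * crossing P + 3 ≤ 2 * crossing P + 2
      too-many = begin
        2 * crossing P + 3       ≡⟨ cong (_+ 3) (sym (Σ-*ˡ {m G} 2 _)) ⟩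
        Σℕ (λ e → 2 * ind ⌊ ¬? (joins? P e) ⌋) + 3 ≤⟨ +-monoˡ-≤ 3 (Σ-mono (two-classes col P)) ⟩
        Σℕ (λ e → Σℕ (λ i → ind ⌊ separated? col Total P i e ⌋)) + 3
          ≡⟨ cong (_+ 3) (Σ-swap {m G} {3} λ e i → ind ⌊ separated? col Total P i e ⌋) ⟩
        Σℕ s + 3                 ≡⟨ +-comm (Σℕ s) 3 ⟩
        3 + Σℕ s                 ≡⟨ sym (Σ-+ {3} (λ _ → 1) s) ⟩
        Σℕ (λ i → 1 + s i)       ≤⟨ Σ-mono few′ ⟩
        Σℕ {3} (λ i → #classes P) ≡⟨ Σ-const 3 (#classes P) ⟩
        3 * #classes P           ≤⟨ many P (λ e Be → iterate-joins-B col N Total Be _) apart ⟩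
        2 * crossing P + 2       ∎

-- Parity of boundaries

infix 4 _≈₂_
-- A record rather than a bare equation of remainders, so that both numbers can be inferred from the
-- type.
record _≈₂_ (a b : ℕ) : Set where
  constructor mod₂
  field same-parity : a % 2 ≡ b % 2
open _≈₂_

≈₂-setoid : Setoid 0ℓ 0ℓ
≈₂-setoid = record
  { Carrier       = ℕ
  ; _≈_           = _≈₂_
  ; isEquivalence = record
    { refl  = mod₂ refl
    ; sym   = λ p → mod₂ (sym (same-parity p))
    ; trans = λ p q → mod₂ (trans (same-parity p) (same-parity q)) } }

open Setoid ≈₂-setoid using ()
  renaming (refl to ≈₂-refl; sym to ≈₂-sym; trans to ≈₂-trans; reflexive to ≈₂-reflexive)

≈₂-+ : ∀ {a b c d} → a ≈₂ b → c ≈₂ d → a + c ≈₂ b + d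
≈₂-+ {a} {b} {c} {d} (mod₂ p) (mod₂ q) = mod₂ (trans (%-distribˡ-+ a c 2)
  (trans (cong₂ (λ x y → (x + y) % 2) p q) (sym (%-distribˡ-+ b d 2))))

≈₂-* : ∀ {a b c d} → a ≈₂ b → c ≈₂ d → a * c ≈₂ b * d
≈₂-* {a} {b} {c} {d} (mod₂ p) (mod₂ q) = mod₂ (trans (%-distribˡ-* a c 2)
  (trans (cong₂ (λ x y → (x * y) % 2) p q) (sym (%-distribˡ-* b d 2))))

double≈₂0 : ∀ a → a + a ≈₂ 0
double≈₂0 a = mod₂ (trans (cong (_% 2) (trans (cong (a +_) (sym (+-identityʳ a))) (*-comm 2 a))) (m*n%n≡0 a 2))

double-cancel : ∀ a b → a + (a + b) ≈₂ b
double-cancel a b = ≈₂-trans (≈₂-reflexive (sym (+-assoc a a b))) (≈₂-+ (double≈₂0 a) ≈₂-refl)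

Σ-≈₂ : ∀ {k} {f g : Fin k → ℕ} → (∀ i → f i ≈₂ g i) → Σℕ f ≈₂ Σℕ g
Σ-≈₂ {zero}  f≈g = ≈₂-refl
Σ-≈₂ {suc k} f≈g = ≈₂-+ (f≈g zero) (Σ-≈₂ (f≈g ∘ suc))

ind-xor : ∀ p q → ind (p xor q) ≈₂ ind p + ind q
ind-xor true  true  = mod₂ refl
ind-xor true  false = mod₂ refl
ind-xor false true  = mod₂ refl
ind-xor false false = mod₂ refl

-- Boundaries of walks, and one-edge cuts

module Walks (G : Graph) where

  -- The pairing of φ with the boundary of x: for φ the indicator of a vertex it is
  -- the degree, and for φ the indicator of a set it has the parity of the cut.
  boundary : (V G → ℕ) → EdgeMultiset G → ℕ
  boundary φ x = Σℕ (λ e → x e * (φ (end₁ G e) + φ (end₂ G e)))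

  boundary-+ : ∀ φ x y → boundary φ (λ e → x e + y e) ≡ boundary φ x + boundary φ y
  boundary-+ φ x y = trans (Σ-cong λ e → *-distribʳ-+ _ (x e) (y e)) (Σ-+ {m G} (λ e → x e * _) _)

  boundary-Σ : ∀ {k} φ (x : Fin k → EdgeMultiset G) →
               boundary φ (λ e → Σℕ (λ i → x i e)) ≡ Σℕ (λ i → boundary φ (x i))
  boundary-Σ φ x = trans (Σ-cong λ e → sym (Σ-*ʳ _ (λ i → x i e))) 
    (Σ-swap {m G} λ e i → x i e * (φ (end₁ G e) + φ (end₂ G e)))

  boundary-≈₂ : ∀ φ {x y} → (∀ e → x e ≈₂ y e) → boundary φ x ≈₂ boundary φ y
  boundary-≈₂ φ x≈y = Σ-≈₂ λ e → ≈₂-* (x≈y e) ≈₂-refl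

  single : E G → EdgeMultiset G
  single e f = ind ⌊ f Fin.≟ e ⌋

  boundary-single : ∀ φ e → boundary φ (single e) ≡ φ (end₁ G e) + φ (end₂ G e)
  boundary-single φ e = trans (Σ-single _ e off) (trans (cong (_* (φ (end₁ G e) + φ (end₂ G e))) (ind-yes (e Fin.≟ e) refl)) (*-identityˡ _))
    where
    off : ∀ f → f ≢ e → single e f * (φ (end₁ G f) + φ (end₂ G f)) ≡ 0
    off f f≢e with f Fin.≟ e
    ... | yes f≡e = contradiction f≡e f≢e
    ... | no _    = refl

  uses : ∀ {x a b} → Reach G x a b → EdgeMultiset G
  uses here        f = 0
  uses (fwd e _ r) f = single e f + uses r f
  uses (bwd e _ r) f = single e f + uses r f

  uses-support : ∀ {x a b} (r : Reach G x a b) f → x f ≡ 0 → uses r f ≡ 0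
  uses-support here          f xf = refl
  uses-support (fwd e xe r) f xf with f Fin.≟ e
  ... | yes refl = contradiction xf xe
  ... | no _     = uses-support r f xf
  uses-support (bwd e xe r) f xf with f Fin.≟ e
  ... | yes refl = contradiction xf xe
  ... | no _     = uses-support r f xf

  -- Each inner vertex of the walk is counted on arrival and on departure, so modulo two only the
  -- ends remain.
  boundary-uses : ∀ φ {x a b} (r : Reach G x a b) → boundary φ (uses r) ≈₂ φ a + φ b
  boundary-uses φ {a = a} here = begin
    boundary φ (λ _ → 0) ≡⟨ Σ-zero {m G} {λ e → 0 * (φ (end₁ G e) + φ (end₂ G e))} (λ e → refl) ⟩
    0                    ≈⟨ double≈₂0 (φ a) ⟨
    φ a + φ a            ∎
    where open SetoidReasoning ≈₂-setoid
  boundary-uses φ {b = b} (fwd e _ r) = begin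
    boundary φ (λ f → single e f + uses r f)      ≡⟨ boundary-+ φ (single e) (uses r) ⟩
    boundary φ (single e) + boundary φ (uses r)   ≈⟨ ≈₂-+ (≈₂-reflexive (boundary-single φ e)) (boundary-uses φ r) ⟩
    (φ u + φ v) + (φ v + φ b)                     ≡⟨ +-assoc (φ u) _ _ ⟩
    φ u + (φ v + (φ v + φ b))                     ≈⟨ ≈₂-+ (≈₂-refl {φ u}) (double-cancel (φ v) (φ b)) ⟩
    φ u + φ b                                     ∎
    where
    open SetoidReasoning ≈₂-setoid
    u = end₁ G e
    v = end₂ G e
  boundary-uses φ {b = b} (bwd e _ r) = begin
    boundary φ (λ f → single e f + uses r f)      ≡⟨ boundary-+ φ (single e) (uses r) ⟩
    boundary φ (single e) + boundary φ (uses r)   ≈⟨ ≈₂-+ (≈₂-reflexive (boundary-single φ e)) (boundary-uses φ r) ⟩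
    (φ u + φ v) + (φ u + φ b)                     ≡⟨ cong (_+ (φ u + φ b)) (+-comm (φ u) (φ v)) ⟩
    (φ v + φ u) + (φ u + φ b)                     ≡⟨ +-assoc (φ v) _ _ ⟩
    φ v + (φ u + (φ u + φ b))                     ≈⟨ ≈₂-+ (≈₂-refl {φ v}) (double-cancel (φ u) (φ b)) ⟩
    φ v + φ b                                     ∎
    where
    open SetoidReasoning ≈₂-setoid
    u = end₁ G e
    v = end₂ G e

  reach-trans : ∀ {x a b c} → Reach G x a b → Reach G x b c → Reach G x a c
  reach-trans here        q = q
  reach-trans (fwd e h p) q = fwd e h (reach-trans p q)
  reach-trans (bwd e h p) q = bwd e h (reach-trans p q)

  reach-sym : ∀ {x a b} → Reach G x a b → Reach G x b a
  reach-sym here        = here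
  reach-sym (fwd e h p) = reach-trans (reach-sym p) (bwd e h here)
  reach-sym (bwd e h p) = reach-trans (reach-sym p) (fwd e h here)

  reach-isEquivalence : ∀ x → IsEquivalence (Reach G x)
  reach-isEquivalence x = record { refl = here ; sym = reach-sym ; trans = reach-trans }

  crosses : Subset (n G) → E G → Bool
  crosses U e = lookup U (end₁ G e) xor lookup U (end₂ G e)

  leaving-edge : ∀ {x a b} (U : Subset (n G)) → Reach G x a b → lookup U a ≢ lookup U b →
                 ∃ λ e → crosses U e ≡ true
  leaving-edge U here a≢a = contradiction refl a≢a
  leaving-edge U (fwd e _ r) a≢b with lookup U (end₁ G e) in p | lookup U (end₂ G e) in q
  ... | true  | false = e , cong₂ _xor_ p q
  ... | false | true  = e , cong₂ _xor_ p q
  ... | true  | true  = leaving-edge U r (a≢b ∘ trans (sym q))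
  ... | false | false = leaving-edge U r (a≢b ∘ trans (sym q))
  leaving-edge U (bwd e _ r) a≢b with lookup U (end₁ G e) in p | lookup U (end₂ G e) in q
  ... | true  | false = e , cong₂ _xor_ p q
  ... | false | true  = e , cong₂ _xor_ p q
  ... | true  | true  = leaving-edge U r (a≢b ∘ trans (sym p))
  ... | false | false = leaving-edge U r (a≢b ∘ trans (sym p))

  -- These are the bridges, given by a one-edge cut so that a search through the vertex subsets
  -- decides the property.
  Lonely : Pred (E G) 0ℓ
  Lonely e = ∃ λ U → cutSize G U ≡ 1 × crosses U e ≡ true

  lonely? : Decidable Lonely
  lonely? e = anySubset? λ U → (cutSize G U Data.Nat.≟ 1) ×-dec (crosses U e Data.Bool.≟ true)

  cutSize-∁ : ∀ U → cutSize G (∁ U) ≡ cutSize G U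
  cutSize-∁ U = Σ-cong λ e → cong ind (trans
    (cong₂ _xor_ (lookup-map (end₁ G e) not U) (lookup-map (end₂ G e) not U))
    (not-xor-not (lookup U (end₁ G e)) (lookup U (end₂ G e))))
    where
    not-xor-not : ∀ p q → not p xor not q ≡ p xor q
    not-xor-not true  true  = refl
    not-xor-not true  false = refl
    not-xor-not false true  = refl
    not-xor-not false false = refl

≢⊤ : ∀ {k} {U : Subset k} {x} → lookup U x ≡ false → U ≢ ⊤
≢⊤ {x = x} x∉U refl with () ← trans (sym x∉U) ([]=⇒lookup (∈⊤ {x = x}))

¬⊤⇒∁-nonempty : ∀ {k} {U : Subset k} → U ≢ ⊤ → Nonempty (∁ U)
¬⊤⇒∁-nonempty {U = U} U≢⊤ with nonempty? (∁ U)
... | yes ne = ne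
... | no ¬ne = contradiction (full U λ x → x∉∁p⇒x∈p λ x∈ → ¬ne (x , x∈)) U≢⊤
  where
  full : ∀ {k} (U : Subset k) → (∀ x → x Subset.∈ U) → U ≡ ⊤
  full Vec.[]      _   = refl
  full (b Vec.∷ U) all = cong₂ Vec._∷_ ([]=⇒lookup (all zero)) (full U λ x → drop (all (suc x)))
    where
    drop : ∀ {k b x} {U : Subset k} → suc x Subset.∈ (b Vec.∷ U) → x Subset.∈ U
    drop (Vec.there p) = p

-- Lower bounds on cuts

module Cuts (G : Graph) (connected : Connected G) (s t : V G)
  (large : ∀ (U : Subset (n G)) → Nonempty U → U ≢ ⊤ →
           ∣ U ∩ (⁅ s ⁆ ∪ ⁅ t ⁆) ∣ ≢ 1 → cutSize G U ≥ 3) where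
  open Walks G
  open Generated G
  open Packing G lonely?

  large-avoiding : ∀ U → Nonempty U → lookup U s ≡ false → lookup U t ≡ false → cutSize G U ≥ 3
  large-avoiding U ne s∉U t∉U = large U ne (≢⊤ s∉U) meets-none
    where
    empty : Subset.Empty (U ∩ (⁅ s ⁆ ∪ ⁅ t ⁆))
    empty (x , x∈) with x∈p∩q⁻ U _ x∈
    ... | x∈U , x∈st with x∈p∪q⁻ ⁅ s ⁆ ⁅ t ⁆ x∈st
    ...   | inj₁ x∈s with refl ← x∈⁅y⁆⇒x≡y s x∈s with () ← trans (sym s∉U) ([]=⇒lookup x∈U)
    ...   | inj₂ x∈t with refl ← x∈⁅y⁆⇒x≡y t x∈t with () ← trans (sym t∉U) ([]=⇒lookup x∈U)

    meets-none : ∣ U ∩ (⁅ s ⁆ ∪ ⁅ t ⁆) ∣ ≢ 1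
    meets-none eq with () ← trans (sym eq) (trans (cong ∣_∣ (Empty-unique empty)) (∣⊥∣≡0 (n G)))

  -- A set containing both ends is replaced by its complement, which has the same cut and avoids
  -- both. This also settles `s ≡ t`: a set containing that vertex meets the pair in one element, so
  -- `large` does not apply to it directly.
  large-unless-separating : ∀ U → Nonempty U → U ≢ ⊤ → lookup U s xor lookup U t ≡ false → cutSize G U ≥ 3
  large-unless-separating U ne U≢⊤ same with lookup U s in p | lookup U t in q
  ... | false | false = large-avoiding U ne p q
  ... | true  | true  = subst (_≥ 3) (cutSize-∁ U) (large-avoiding (∁ U) (¬⊤⇒∁-nonempty U≢⊤)
    (trans (lookup-map s not U) (cong not p)) (trans (lookup-map t not U) (cong not q)))
  large-unless-separating U ne U≢⊤ () | true  | false
  large-unless-separating U ne U≢⊤ () | false | true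

  -- Connectedness gives a crossing edge; were it the only one, it would be lonely.
  separating-cut≥2 : ∀ U → lookup U s ≢ lookup U t → (∀ e → Lonely e → crosses U e ≡ false) → 2 ≤ cutSize G U
  separating-cut≥2 U sep none with leaving-edge U (connected s t) sep
  ... | e , ce = ≤∧≢⇒< (subst (_≤ cutSize G U) (cong ind ce) (term≤Σ (λ f → ind (crosses U f)) e)) not-1
    where
    not-1 : 1 ≢ cutSize G U
    not-1 eq with () ← trans (sym ce) (none e (U , sym eq , ce))

  -- This is the cut condition for `G` with an extra edge from `s` to `t`, which supplies the third
  -- edge of a separating cut.
  cut-bound : ∀ U → Nonempty U → U ≢ ⊤ → (∀ e → Lonely e → crosses U e ≡ false) →
              3 ≤ cutSize G U + ind (lookup U s xor lookup U t)
  cut-bound U ne U≢⊤ none with lookup U s xor lookup U t in eq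
  ... | false = ≤-trans (large-unless-separating U ne U≢⊤ eq) (m≤m+n _ _)
  ... | true  = +-monoˡ-≤ 1 (separating-cut≥2 U (λ p → differ p eq) none)
    where
    differ : ∀ {p q : Bool} → p ≡ q → p xor q ≢ true
    differ {true}  refl ()
    differ {false} refl ()

  -- The partition inequality

  module _ (P : Equivalence) (lonely-joined : ∀ e → Lonely e → joins P e)
           (apart : ∃ λ a → ∃ λ b → ¬ rel P a b) where

    in-class : V G → V G → Bool
    in-class a b = ⌊ rel? P a b ⌋

    class : V G → Subset (n G)
    class a = Vec.tabulate (in-class a)

    in-class-cong : ∀ {u v} a → rel P u v → in-class a u ≡ in-class a v
    in-class-cong {u} {v} a u~v with rel? P a u | rel? P a v
    ... | yes _   | yes _   = refl
    ... | no _    | no _    = refl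
    ... | yes a~u | no a≁v  = contradiction (~trans P a~u u~v) a≁v
    ... | no a≁u  | yes a~v = contradiction (~trans P a~v (~sym P u~v)) a≁u

    xor-same : ∀ {p q} → p ≡ q → p xor q ≡ false
    xor-same {true}  refl = refl
    xor-same {false} refl = refl

    lookup-class : ∀ a b → lookup (class a) b ≡ in-class a b
    lookup-class a = lookup∘tabulate (in-class a)

    class-nonempty : ∀ a → Nonempty (class a)
    class-nonempty a = a , lookup⇒[]= a (class a) (trans (lookup-class a a) self)
      where
      self : in-class a a ≡ true
      self with rel? P a a
      ... | yes _ = refl
      ... | no ¬r = contradiction (~refl P) ¬r

    class≢⊤ : ∀ a → class a ≢ ⊤
    class≢⊤ a eq = let x , y , x≁y = apart in x≁y (~trans P (~sym P (related x)) (related y))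
      where
      related : ∀ b → rel P a b
      related b with rel? P a b | trans (sym (lookup-class a b)) (trans (cong (λ U → lookup U b) eq) ([]=⇒lookup (∈⊤ {x = b})))
      ... | yes r | _ = r

    class-bound : ∀ a → 3 ≤ Σℕ (λ e → ind (in-class a (end₁ G e) xor in-class a (end₂ G e)))
                            + ind (in-class a s xor in-class a t)
    class-bound a = subst (3 ≤_)
      (cong₂ _+_ (Σ-cong λ e → cong ind (cong₂ _xor_ (lookup-class a (end₁ G e)) (lookup-class a (end₂ G e))))
                 (cong ind (cong₂ _xor_ (lookup-class a s) (lookup-class a t))))
      (cut-bound (class a) (class-nonempty a) (class≢⊤ a) λ e le →
        xor-same (trans (lookup-class a _) (trans (in-class-cong a (lonely-joined e le)) (sym (lookup-class a _)))))

    least : V G → ℕ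
    least a = ind ⌊ least? P a ⌋

    -- The number of blocks containing exactly one of `u` and `v`, each block counted at its least
    -- vertex.
    separations : V G → V G → ℕ
    separations u v = Σℕ (λ a → least a * ind (in-class a u xor in-class a v))

    least-in-class≤1 : ∀ u → Σℕ (λ a → least a * ind (in-class a u)) ≤ 1
    least-in-class≤1 u = ≤-trans (≤-reflexive (Σ-cong both)) (count-at-most-one both? unique)
      where
      both? : Decidable (λ a → Least P a × rel P a u)
      both? a = least? P a ×-dec rel? P a u
      both : ∀ a → least a * ind (in-class a u) ≡ ind ⌊ both? a ⌋
      both a with least? P a | rel? P a u
      ... | yes _ | yes _ = refl
      ... | yes _ | no _  = refl
      ... | no _  | yes _ = refl
      ... | no _  | no _  = refl
      unique : ∀ {a b} → Least P a × rel P a u → Least P b × rel P b u → a ≡ b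
      unique (la , a~u) (lb , b~u) = least-unique P la lb (~trans P a~u (~sym P b~u))

    separations≤2 : ∀ u v → separations u v ≤ 2
    separations≤2 u v = ≤-trans (Σ-mono pointwise) (≤-trans (≤-reflexive (Σ-+ {n G} _ _))
      (+-mono-≤ (least-in-class≤1 u) (least-in-class≤1 v)))
      where
      ind-xor≤ : ∀ p q → ind (p xor q) ≤ ind p + ind q
      ind-xor≤ true  true  = z≤n
      ind-xor≤ true  false = ≤-refl
      ind-xor≤ false q     = ≤-refl
      pointwise : ∀ a → least a * ind (in-class a u xor in-class a v) ≤
                        least a * ind (in-class a u) + least a * ind (in-class a v)
      pointwise a = ≤-trans (*-monoʳ-≤ (least a) (ind-xor≤ (in-class a u) (in-class a v)))
                            (≤-reflexive (*-distribˡ-+ (least a) _ _))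

    separations-edge : ∀ e → separations (end₁ G e) (end₂ G e) ≤ 2 * ind ⌊ ¬? (joins? P e) ⌋
    separations-edge e with joins? P e
    ... | no _   = separations≤2 _ _
    ... | yes je = ≤-reflexive (Σ-zero λ a →
      trans (cong (λ b → least a * ind b) (xor-same (in-class-cong a je))) (*-zeroʳ (least a)))

    -- Sum `class-bound` over the blocks and exchange the sums. A crossing edge counts for at most
    -- two blocks, an edge inside a block for none, and the pair `s`, `t` for at most two, whence
    -- the final 2.
    partition-bound : 3 * #classes P ≤ 2 * crossing P + 2
    partition-bound = begin
      3 * Σℕ least                              ≡⟨ *-comm 3 (Σℕ least) ⟩
      Σℕ least * 3                              ≡⟨ Σ-*ʳ 3 least ⟨
      Σℕ (λ a → least a * 3)                    ≤⟨ Σ-mono (λ a → *-monoʳ-≤ (least a) (class-bound a)) ⟩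
      Σℕ (λ a → least a * (Σℕ (λ e → x a e) + ind (in-class a s xor in-class a t)))
        ≡⟨ Σ-cong (λ a → *-distribˡ-+ (least a) (Σℕ (λ e → x a e)) _) ⟩
      Σℕ (λ a → least a * Σℕ (λ e → x a e) + least a * ind (in-class a s xor in-class a t))
        ≡⟨ Σ-+ {n G} (λ a → least a * Σℕ (λ e → x a e)) _ ⟩
      Σℕ (λ a → least a * Σℕ (λ e → x a e)) + separations s t
        ≡⟨ cong (_+ separations s t) (Σ-cong λ a → sym (Σ-*ˡ (least a) (x a))) ⟩
      Σℕ (λ a → Σℕ (λ e → least a * x a e)) + separations s t
        ≡⟨ cong (_+ separations s t) (Σ-swap {n G} {m G} λ a e → least a * x a e) ⟩
      Σℕ (λ e → separations (end₁ G e) (end₂ G e)) + separations s t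
        ≤⟨ +-mono-≤ (Σ-mono separations-edge) (separations≤2 s t) ⟩
      Σℕ (λ e → 2 * ind ⌊ ¬? (joins? P e) ⌋) + 2 ≡⟨ cong (_+ 2) (Σ-*ˡ {m G} 2 _) ⟩
      2 * crossing P + 2                        ∎
      where
      open ≤-Reasoning
      x : V G → E G → ℕ
      x a e = ind (in-class a (end₁ G e) xor in-class a (end₂ G e))

  three-subgraphs : ∃ λ col → ∀ i a b → rel (generated (class? col i)) a b
  three-subgraphs = packing s partition-bound

  third : Fin 3
  third = suc (suc zero)

  support : Colouring → EdgeMultiset G
  support col e = ind ⌊ class? col third e ⌋

  spanning⇒connected : ∀ {col i} x → (∀ a b → rel (generated (class? col i)) a b) →
                       (∀ e → Class col i e → x e ≢ 0) → ConnectedMS G x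
  spanning⇒connected {col} {i} x spanning pos a b = generated-least (class? col i) (reach-isEquivalence x)
    (λ e ce → fwd e (pos e ce) here) (spanning a b)

  -- The two tours

  module Tours (col : Colouring) (spanning : ∀ i a b → rel (generated (class? col i)) a b)
               (walk : ConnectedMS G (support col)) where

    ones : EdgeMultiset G
    ones _ = 1

    -- Replacing every edge of G, and a further edge st, by a walk in the third
    -- subgraph yields the parities of G + st.
    detours : EdgeMultiset G
    detours f = Σℕ (λ e → uses (walk (end₁ G e) (end₂ G e)) f) + uses (walk s t) f

    -- Modulo two, a walk has the same boundary as the edge it replaces. A general `φ` serves both
    -- vertices, for the degrees, and vertex sets, for the one-edge cuts.
    boundary-detours : ∀ φ → boundary φ detours ≈₂ boundary φ ones + (φ s + φ t)
    boundary-detours φ = begin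
      boundary φ detours
        ≡⟨ boundary-+ φ (λ f → Σℕ (λ e → w e f)) (uses (walk s t)) ⟩
      boundary φ (λ f → Σℕ (λ e → w e f)) + boundary φ (uses (walk s t))
        ≡⟨ cong (_+ boundary φ (uses (walk s t))) (boundary-Σ φ w) ⟩
      Σℕ (λ e → boundary φ (w e)) + boundary φ (uses (walk s t))
        ≈⟨ ≈₂-+ (Σ-≈₂ λ e → boundary-uses φ (walk (end₁ G e) (end₂ G e))) (boundary-uses φ (walk s t)) ⟩
      Σℕ (λ e → φ (end₁ G e) + φ (end₂ G e)) + (φ s + φ t)
        ≡⟨ cong (_+ (φ s + φ t)) (Σ-cong λ e → sym (*-identityˡ (φ (end₁ G e) + φ (end₂ G e)))) ⟩
      boundary φ ones + (φ s + φ t) ∎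
      where
      open SetoidReasoning ≈₂-setoid
      w : E G → EdgeMultiset G
      w e = uses (walk (end₁ G e) (end₂ G e))

    detours-support : ∀ f → ¬ Class col third f → detours f ≡ 0
    detours-support f ¬cf = cong₂ _+_ (Σ-zero λ e → uses-support (walk (end₁ G e) (end₂ G e)) f off) (uses-support (walk s t) f off)
      where
      off : support col f ≡ 0
      off with class? col third f
      ... | yes cf = contradiction cf ¬cf
      ... | no _   = refl

    -- The one-edge cut separates `s` from `t`, or it would have three edges. The detours therefore
    -- cross it with parity 1 + 1, and they can cross it only through `e`.
    lonely-even : ∀ e → Lonely e → detours e ≈₂ 0
    lonely-even e (U , one , ce) = begin
      detours e                                 ≡⟨ *-identityʳ (detours e) ⟨
      detours e * 1                             ≡⟨ cong (λ b → detours e * ind b) ce ⟨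
      detours e * ind (crosses U e)             ≡⟨ Σ-single _ e off ⟨
      Σℕ (λ f → detours f * ind (crosses U f))  ≈⟨ Σ-≈₂ (λ f → ≈₂-* (≈₂-refl {detours f}) (ind-xor (lookup U (end₁ G f)) (lookup U (end₂ G f)))) ⟩
      boundary φ detours                        ≈⟨ boundary-detours φ ⟩
      boundary φ ones + (φ s + φ t)             ≈⟨ ≈₂-+ cut-parity (≈₂-sym (ind-xor (lookup U s) (lookup U t))) ⟩
      cutSize G U + ind (lookup U s xor lookup U t) ≡⟨ cong₂ _+_ one (cong ind separates) ⟩
      2                                         ≈⟨ mod₂ refl ⟩
      0                                         ∎
      where
      open SetoidReasoning ≈₂-setoid
      φ : V G → ℕ
      φ v = ind (lookup U v)

      cut-parity : boundary φ ones ≈₂ cutSize G U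
      cut-parity = Σ-≈₂ λ f → ≈₂-trans (≈₂-reflexive (*-identityˡ (φ (end₁ G f) + φ (end₂ G f))))
                                   (≈₂-sym (ind-xor (lookup U (end₁ G f)) (lookup U (end₂ G f))))

      off : ∀ f → f ≢ e → detours f * ind (crosses U f) ≡ 0
      off f f≢e with crosses U f in cf
      ... | false = *-zeroʳ (detours f)
      ... | true  = contradiction
        (≤-trans (two-terms≤Σ (λ g → ind (crosses U g)) f≢e) (≤-reflexive one))
        (subst (λ z → ¬ (z ≤ 1)) (sym (cong₂ (λ p q → ind p + ind q) cf ce)) λ { (s≤s ()) })

      nonempty-proper : ∀ {u v} → lookup U u xor lookup U v ≡ true → Nonempty U × U ≢ ⊤
      nonempty-proper {u} {v} uv with lookup U u in p | lookup U v in q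
      ... | true  | false = (u , lookup⇒[]= u U p) , ≢⊤ q
      ... | false | true  = (v , lookup⇒[]= v U q) , ≢⊤ p

      separates : lookup U s xor lookup U t ≡ true
      separates with lookup U s xor lookup U t in eq
      ... | true  = refl
      ... | false = contradiction (large-unless-separating U (proj₁ (nonempty-proper ce)) (proj₂ (nonempty-proper ce)) eq)
                                  (subst (λ z → ¬ (3 ≤ z)) (sym one) λ { (s≤s ()) })

    -- Outside the odd part of the detours every edge is used once; the odd part
    -- avoids the first or the second subgraph edgewise, so its edges are deleted
    -- in one tour and doubled in the other.
    multiplicity : Fin 2 → ℕ → Fin 3 → ℕ
    multiplicity _          zero    _       = 1
    multiplicity zero       (suc _) zero    = 0
    multiplicity zero       (suc _) (suc _) = 2
    multiplicity (suc zero) (suc _) zero    = 2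
    multiplicity (suc zero) (suc _) (suc _) = 0

    tour : Fin 2 → EdgeMultiset G
    tour i e = multiplicity i (detours e % 2) (col e)

    odd⇒¬lonely : ∀ e {r} → detours e % 2 ≡ suc r → ¬ Lonely e
    odd⇒¬lonely e odd le = contradiction (trans (sym odd) (same-parity (lonely-even e le))) λ ()

    odd⇒class : ∀ e {r} → detours e % 2 ≡ suc r → Class col third e
    odd⇒class e odd = decidable-stable (class? col third e) λ ¬ce →
      contradiction (trans (sym odd) (cong (_% 2) (detours-support e ¬ce))) λ ()

    multiplicity-parity : ∀ i {r} c → r < 2 → multiplicity i r c ≈₂ 1 + r
    multiplicity-parity _          {zero}        _       _ = ≈₂-refl
    multiplicity-parity zero       {suc zero}    zero    _ = mod₂ refl
    multiplicity-parity zero       {suc zero}    (suc _) _ = mod₂ refl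
    multiplicity-parity (suc zero) {suc zero}    zero    _ = mod₂ refl
    multiplicity-parity (suc zero) {suc zero}    (suc _) _ = mod₂ refl
    multiplicity-parity _          {suc (suc _)} _       (s≤s (s≤s ()))

    -- Deleting an edge and doubling it both flip the parity of its single copy.
    tour-parity : ∀ i e → tour i e ≈₂ 1 + detours e
    tour-parity i e = ≈₂-trans (multiplicity-parity i (col e) (m%n<n (detours e) 2))
                               (≈₂-+ (≈₂-refl {1}) (mod₂ (m%n%n≡m%n (detours e) 2)))

    tour-connected : ∀ i → ConnectedMS G (tour i)
    tour-connected zero = spanning⇒connected (tour zero) (spanning zero) pos
      where
      pos : ∀ e → Class col zero e → tour zero e ≢ 0
      pos e ce with detours e % 2 in odd | col e in ec
      ... | zero  | _       = λ ()
      ... | suc _ | suc _   = λ ()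
      ... | suc _ | zero    = λ _ → [ odd⇒¬lonely e odd , (λ c≢0 → c≢0 refl) ] ce
    tour-connected (suc zero) = spanning⇒connected (tour (suc zero)) (spanning (suc zero)) pos
      where
      pos : ∀ e → Class col (suc zero) e → tour (suc zero) e ≢ 0
      pos e ce with detours e % 2 in odd | col e in ec
      ... | zero  | _                = λ ()
      ... | suc _ | zero             = λ ()
      ... | suc _ | suc zero         = λ _ → [ odd⇒¬lonely e odd , (λ c≢1 → c≢1 refl) ] ce
      -- Colour two, which this tour would delete, cannot occur: an odd edge lies in the third
      -- subgraph and is not lonely.
      ... | suc _ | suc (suc zero)   = λ _ → [ odd⇒¬lonely e odd , (λ c≢2 → c≢2 ec) ] (odd⇒class e odd)

    -- Adding `detours` to `ones` counts the degrees of `G` twice. They cancel modulo two and leave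
    -- the extra pair `s`, `t`.
    tour-degree : ∀ i a → deg G (tour i) a % 2 ≡ ind (inSymDiff s t a)
    tour-degree i a = trans (same-parity degree) (ends (s Fin.≟ a) (t Fin.≟ a) (a Fin.≟ s) (a Fin.≟ t))
      where
      open SetoidReasoning ≈₂-setoid
      φ : V G → ℕ
      φ v = ind ⌊ v Fin.≟ a ⌋

      degree : deg G (tour i) a ≈₂ φ s + φ t
      degree = begin
        boundary φ (tour i)                             ≈⟨ boundary-≈₂ φ (tour-parity i) ⟩
        boundary φ (λ e → 1 + detours e)                ≡⟨ boundary-+ φ ones detours ⟩
        boundary φ ones + boundary φ detours            ≈⟨ ≈₂-+ (≈₂-refl {boundary φ ones}) (boundary-detours φ) ⟩
        boundary φ ones + (boundary φ ones + (φ s + φ t)) ≈⟨ double-cancel (boundary φ ones) (φ s + φ t) ⟩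
        φ s + φ t                                       ∎

      -- `deg` tests `s ≡ a` while `inSymDiff` tests `a ≡ s`, hence the decisions in both
      -- directions. If `s` and `t` both equal `a`, the sum 2 reduces to 0.
      ends : (p : Dec (s ≡ a)) (q : Dec (t ≡ a)) (p′ : Dec (a ≡ s)) (q′ : Dec (a ≡ t)) →
             (ind ⌊ p ⌋ + ind ⌊ q ⌋) % 2 ≡ ind (⌊ p′ ⌋ xor ⌊ q′ ⌋)
      ends (yes p) _       (no p′)  _        = contradiction (sym p) p′
      ends (no p)  _       (yes p′) _        = contradiction (sym p′) p
      ends _       (yes q) _        (no q′)  = contradiction (sym q) q′
      ends _       (no q)  _        (yes q′) = contradiction (sym q′) q
      ends (yes _) (yes _) (yes _)  (yes _)  = refl
      ends (yes _) (no _)  (yes _)  (no _)   = refl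
      ends (no _)  (yes _) (no _)   (yes _)  = refl
      ends (no _)  (no _)  (no _)   (no _)   = refl

    multiplicity-average : ∀ r c → Σℚ (λ i → ½ ℚ.* toℚ (multiplicity i r c)) ≡ 1ℚ
    multiplicity-average zero    _       = refl
    multiplicity-average (suc _) zero    = refl
    multiplicity-average (suc _) (suc _) = refl

    ones-average : ConvexCombOfTours G s t
    ones-average = 2 , tour , (λ _ → ½) , (λ i → tour-connected i , tour-degree i) ,
      (λ _ → nonNegative⁻¹ ½) , refl , λ e → multiplicity-average (detours e % 2) (col e)

theorem11 : (G : Graph) → Connected G → (s t : V G) →
    (∀ (U : Subset (n G)) → Nonempty U → U ≢ ⊤ →
    ∣ U ∩ (⁅ s ⁆ ∪ ⁅ t ⁆) ∣ ≢ 1 → cutSize G U ≥ 3) →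
    ConvexCombOfTours G s t
theorem11 G connected s t large =
  let col , spanning = three-subgraphs in Tours.ones-average col spanning
    -- The detour walks run inside the third subgraph, so edges outside it stay out of the odd part.
    (spanning⇒connected (support col) (spanning third) λ e ce eq →
      contradiction (trans (sym (ind-yes (class? col third e) ce)) eq) λ ())
  where
  open Cuts G connected s t large
  open Packing G (Walks.lonely? G)
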